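{- For every $n,a,b\geq 0$, the number of partitions $\lambda$ of $n$ satisfying $r(\lambda)=a$ and $s(\lambda)=b$ equals the number of partitions of $n$ with exactly $a$ even parts and exactly $b$ odd parts (parts counted with multiplicity).
   Context: For an integer partition $\lambda$, pair equal parts of $\lambda$ as far as possible: for each part size occurring with odd multiplicity exactly one copy remains unpaired, and a part size of even multiplicity is completely paired. Let $r(\lambda)$ be the largest part size that participates in at least one pair (i.e. the largest part size of multiplicity at least $2$), with $r(\lambda)=0$ if $\lambda$ has distinct parts. Write the unpaired parts (the part sizes of odd multiplicity, each once) in decreasing order $u_1>u_2>\cdots>u_s$ and let $s(\lambda)=u_1-u_2+u_3-u_4+\cdots$ (so $s(\lambda)=0$ if there are no unpaired parts). -}

module Defs where

open import Data.Fin.Base using (Fin)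
open import Data.Integer.Base as ℤ using (ℤ; +_)
open import Data.List.Base using (List; []; _∷_; length; filter; deduplicate)
open import Data.List.Extrema.Nat using (max)
open import Data.List.Relation.Unary.All using (All)
open import Data.List.Relation.Unary.Linked using (Linked)
open import Data.Nat.Base using (ℕ; _≥_; _>_)
open import Data.Nat.Divisibility using (_∣?_)
open import Data.Nat.ListAction using (sum)
open import Data.Nat.Properties using (_≟_; _≤?_)
open import Function.Base using (_∘_)
open import Function.Bundles using (_↔_)
open import Relation.Binary.PropositionalEquality using (_≡_)
open import Relation.Nullary.Decidable using (¬?)

-- Each proof field is a proposition (any two inhabitants are equal), so
-- partitions are equal exactly when their lists of parts are.
record Partition (n : ℕ) : Set where
  constructor mkPartition
  field
    parts      : List ℕ
    decreasing : Linked _≥_ parts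
    positive   : All (_> 0) parts
    sums       : sum parts ≡ n

open Partition public

multiplicity : ℕ → List ℕ → ℕ
multiplicity i xs = length (filter (i ≟_) xs)

repeatedParts : List ℕ → List ℕ
repeatedParts xs = filter (λ i → 2 ≤? multiplicity i xs) xs

-- deduplicate and filter preserve order, so for a partition this is
-- the strictly decreasing list u₁ > u₂ > ⋯ > uₛ.
unpairedParts : List ℕ → List ℕ
unpairedParts xs =
  filter (λ i → ¬? (2 ∣? multiplicity i xs)) (deduplicate _≟_ xs)

-- u₁ - (u₂ - (u₃ - ⋯)) = u₁ - u₂ + u₃ - ⋯
alternatingSum : List ℕ → ℤ
alternatingSum []       = + 0
alternatingSum (u ∷ us) = + u ℤ.- alternatingSum us

r : ∀ {n} → Partition n → ℕ
r p = max 0 (repeatedParts (parts p))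

s : ∀ {n} → Partition n → ℤ
s p = alternatingSum (unpairedParts (parts p))

#evenParts : ∀ {n} → Partition n → ℕ
#evenParts p = length (filter (2 ∣?_) (parts p))

#oddParts : ∀ {n} → Partition n → ℕ
#oddParts p = length (filter (¬? ∘ (2 ∣?_)) (parts p))

HasCardinality : Set → ℕ → Set
HasCardinality A k = A ↔ Fin k

{-# OPTIONS --safe #-}
module Submission where

-- Write λ = μ ∪ μ ∪ ν, where μ lists one part of each pair and ν the unpaired
-- parts.  Conjugation sends μ, whose largest part is r(λ), to a partition with
-- r(λ) parts, and doubling these gives the even parts.  Sylvester's bijection
-- sends ν, which has distinct parts and alternating sum s(λ), to a partition of
-- |ν| into s(λ) odd parts.  Writing an odd partition as 2kᵢ + 1 with
-- k₁ ≥ ⋯ ≥ k_b, of which exactly m + 1 satisfy 2kᵢ + 1 ≥ 3, it peels off two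
-- hooks: u₁ = b + k₁, u₂ = k₁ + m, and the m numbers k₂ − 1, …, k_{m+1} − 1
-- determine u₃, u₄, ….

open import Axiom.UniquenessOfIdentityProofs using (module Decidable⇒UIP)
open import Data.Fin.Base using (Fin)
import Data.Integer.Base as ℤ
import Data.Integer.Properties as ℤ
open import Data.List.Base
  using (List; []; _∷_; _++_; length; map; filter; deduplicate; upTo; cartesianProductWith; lookup;
         replicate)
open import Data.List.Extrema.Nat using (max; max≤v⁺; v≤max⁺)
open import Data.List.Membership.Propositional using (_∈_)
open import Data.List.Membership.Propositional.Properties
  using (∈-filter⁺; ∈-filter⁻; ∈-deduplicate⁺; ∈-length; ∈-lookup;
         ∈-cartesianProductWith⁺; ∈-upTo⁺)
open import Data.List.Membership.Propositional.Properties.WithK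
  using (unique∧set⇒bag; unique⇒irrelevant)
open import Data.List.Properties
  using (length-++; length-map; length-replicate; filter-all; filter-none; filter-accept;
         filter-reject; filter-++; ∷-injectiveˡ; ∷-injectiveʳ; partition-defn;
         ++-identityʳ; map-injective; ≡-dec)
open import Data.List.Relation.Binary.BagAndSetEquality using (∼bag⇒↭)
open import Data.List.Relation.Binary.Permutation.Propositional
  using (_↭_; prep; ↭-refl; ↭-sym; ↭-trans; ↭-reflexive; ↭⇒↭ₛ; ↭ₛ⇒↭)
open import Data.List.Relation.Binary.Permutation.Propositional.Properties
  using (All-resp-↭; ↭-length; filter-↭; shift; drop-∷)
import Data.List.Relation.Binary.Permutation.Setoid.Properties as Permutationₛ
open import Data.List.Relation.Binary.Pointwise using (Pointwise-≡⇒≡)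
open import Data.List.Relation.Unary.All as All using (All; []; _∷_)
import Data.List.Relation.Unary.All.Properties as All
open import Data.List.Relation.Unary.AllPairs as AllPairs using ([]; _∷_)
import Data.List.Relation.Unary.AllPairs.Properties as AllPairs
open import Data.List.Relation.Unary.Any as Any using (here; there)
open import Data.List.Relation.Unary.Any.Properties using (lookup-index)
open import Data.List.Relation.Unary.Linked as Linked using (Linked; []; [-]; _∷_)
import Data.List.Relation.Unary.Linked.Properties as Linked
open import Data.List.Relation.Unary.Sorted.TotalOrder.Properties using (↗↭↗⇒≋)
open import Data.List.Relation.Unary.Unique.Propositional using (Unique)
open import Data.List.Relation.Unary.Unique.DecPropositional.Properties using (deduplicate-!)
import Data.List.Sort
open import Data.Nat.Base
open import Data.Nat.Induction using (<-wellFounded)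
open import Data.Nat.Divisibility using (_∣_; _∣?_; divides; ∣m+n∣m⇒∣n; ∣1⇒≡1; n∣m*n)
open import Data.Nat.ListAction using (sum)
open import Data.Nat.ListAction.Properties using (sum-++; sum-↭)
open import Data.Nat.Properties
open import Data.Nat.Tactic.RingSolver using (solve-∀)
open import Data.Product.Base using (_×_; _,_; proj₁; proj₂; Σ; Σ-syntax; ∃-syntax)
open import Data.Sum.Base using (inj₂)
open import Function.Base using (_∘_)
open import Function.Bundles using (_↔_; mk↔ₛ′; mk⇔)
open import Function.Properties.Inverse using (↔-trans)
open import Relation.Binary.Bundles using (DecTotalOrder)
open import Relation.Binary.Definitions using (DecidableEquality)
open import Relation.Binary.Properties.DecTotalOrder ≤-decTotalOrder
  using (≥-decTotalOrder; ≥-trans)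
open import Relation.Binary.PropositionalEquality
open import Relation.Nullary.Decidable using (yes; no; ¬?; _×-dec_)
open import Relation.Nullary.Negation using (¬_; contradiction)
open import Induction.WellFounded using (Acc; acc)
open import Level using (0ℓ)
open import Relation.Unary using (Decidable; Irrelevant; Pred)
open import Defs

open Data.List.Sort ≥-decTotalOrder using (sort; sort-↭; sort-↗)

-- Heads of decreasing lists.

largest : List ℕ → ℕ
largest []      = 0
largest (x ∷ _) = x

head≥ : ∀ {x xs} → Linked _≥_ (x ∷ xs) → largest xs ≤ x
head≥ [-]       = z≤n
head≥ (x≥y ∷ _) = x≥y

cons≥ : ∀ {x xs} → largest xs ≤ x → Linked _≥_ xs → Linked _≥_ (x ∷ xs)
cons≥ {xs = []}    _   _  = [-]
cons≥ {xs = _ ∷ _} y≤x ↘ = y≤x ∷ ↘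

-- Since `largest []` is 0, the one-element case is exactly positivity of `x`.
head> : ∀ {x xs} → Linked _>_ (x ∷ xs) → All (_> 0) (x ∷ xs) → largest xs < x
head> [-]       (x>0 ∷ _) = x>0
head> (x>y ∷ _) _         = x>y

cons> : ∀ {x xs} → largest xs < x → Linked _>_ xs → Linked _>_ (x ∷ xs)
cons> {xs = []}    _   _  = [-]
cons> {xs = _ ∷ _} y<x ↘ = y<x ∷ ↘

-- Raising every entry and appending zeros.

-- Every decreasing list arises exactly once: `z` counts its zeros and `zs` holds its positive
-- entries lowered by one. `conj` and `sylvester` are both recursions along this decomposition.
stack : List ℕ → ℕ → List ℕ
stack zs z = map suc zs ++ replicate z 0

length-stack : ∀ zs z → length (stack zs z) ≡ length zs + z
length-stack zs z = trans (length-++ (map suc zs))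
  (cong₂ _+_ (length-map suc zs) (length-replicate z))

largest-stack : ∀ zs z → largest (stack zs z) ≤ suc (largest zs)
largest-stack []       zero    = z≤n
largest-stack []       (suc z) = z≤n
largest-stack (x ∷ zs) z       = ≤-refl

stack-↘ : ∀ {zs} z → Linked _≥_ zs → Linked _≥_ (stack zs z)
stack-↘ zero    []            = []
stack-↘ (suc z) []            = cons≥ (largest-stack≤0 z) (stack-↘ z [])
  where
  largest-stack≤0 : ∀ z → largest (replicate z 0) ≤ 0
  largest-stack≤0 zero    = z≤n
  largest-stack≤0 (suc z) = z≤n
stack-↘ {x ∷ zs} z ↘ =
  cons≥ (≤-trans (largest-stack zs z) (s≤s (head≥ ↘))) (stack-↘ z (Linked.tail ↘))

stack-injective : ∀ zs {z} ws {w} → stack zs z ≡ stack ws w → zs ≡ ws × z ≡ w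
stack-injective [] {z} [] {w} eq =
  refl , trans (sym (length-replicate z)) (trans (cong length eq) (length-replicate w))
stack-injective []       {zero}  (x ∷ ws) ()
stack-injective []       {suc z} (x ∷ ws) ()
stack-injective (x ∷ zs) []       {zero}  ()
stack-injective (x ∷ zs) []       {suc w} ()
stack-injective (x ∷ zs) (y ∷ ws) eq with stack-injective zs ws (∷-injectiveʳ eq)
... | refl , refl = cong (_∷ zs) (suc-injective (∷-injectiveˡ eq)) , refl

unstack : ∀ {ks} → Linked _≥_ ks → ∃[ zs ] ∃[ z ] stack zs z ≡ ks × Linked _≥_ zs
unstack {[]}     _ = [] , 0 , refl , []
unstack {k ∷ ks} ↘ with unstack (Linked.tail ↘)
unstack {zero ∷ _}  ↘  | []     , z , refl , _   = [] , suc z , refl , []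
-- A zero cannot precede the positive entry `suc x`.
unstack {zero ∷ _}  ↘  | x ∷ zs , z , refl , _   with () ← head≥ ↘
unstack {suc k ∷ _} ↘  | []     , z , refl , _   = k ∷ [] , z , refl , [-]
unstack {suc k ∷ _} ↘  | x ∷ zs , z , refl , zs↘ =
  k ∷ x ∷ zs , z , refl , s≤s⁻¹ (head≥ ↘) ∷ zs↘

-- Encodings of even and odd parts.

-- A decreasing list of numbers k ≥ 0 encodes the even parts 2(k + 1), via
-- double, or the odd parts 2k + 1, via odd.
double : ℕ → ℕ
double k = suc k * 2

odd : ℕ → ℕ
odd k = suc (k * 2)

sum-double-stack : ∀ zs z →
  sum (map double (stack zs z)) ≡ sum (map double zs) + (length zs + z) * 2
sum-double-stack []       zero    = refl
sum-double-stack []       (suc z) = cong (2 +_) (sum-double-stack [] z)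
sum-double-stack (x ∷ zs) z       =
  trans (cong (double (suc x) +_) (sum-double-stack zs z))
        (lemma x (sum (map double zs)) (length zs + z))
  where
  lemma : ∀ x a b → suc (suc x) * 2 + (a + b * 2) ≡ suc x * 2 + a + suc b * 2
  lemma = solve-∀

sum-odd-stack : ∀ zs z →
  sum (map odd (stack zs z)) ≡ sum (map odd zs) + length zs * 2 + z
sum-odd-stack []       zero    = refl
sum-odd-stack []       (suc z) = cong suc (sum-odd-stack [] z)
sum-odd-stack (x ∷ zs) z       =
  trans (cong (odd (suc x) +_) (sum-odd-stack zs z))
        (lemma x (sum (map odd zs)) (length zs) z)
  where
  lemma : ∀ x a b c → suc (suc x * 2) + (a + b * 2 + c) ≡ suc (x * 2) + a + suc b * 2 + c
  lemma = solve-∀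

-- Conjugation.

-- The conjugate with every part lowered by one: a new largest row x raises the
-- existing columns and adds columns of height one.
conj : List ℕ → List ℕ
conj []       = []
conj (x ∷ xs) = stack (conj xs) (x ∸ length (conj xs))

conj-↘ : ∀ xs → Linked _≥_ (conj xs)
conj-↘ []       = []
conj-↘ (x ∷ xs) = stack-↘ (x ∸ length (conj xs)) (conj-↘ xs)

-- The truncated subtraction in `conj` is exact: by induction the tail has `largest xs` columns, at
-- most `x`.
length-conj : ∀ {xs} → Linked _≥_ xs → length (conj xs) ≡ largest xs
length-conj {[]}     _ = refl
length-conj {x ∷ xs} ↘ = trans (length-stack (conj xs) _)
  (m+[n∸m]≡n (≤-trans (≤-reflexive (length-conj (Linked.tail ↘))) (head≥ ↘)))

-- A new row `x` adds one cell to each of `x` columns, counting the newly created ones, and `double`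
-- makes every cell weigh 2.
sum-conj : ∀ {xs} → Linked _≥_ xs → sum (map double (conj xs)) ≡ sum xs * 2
sum-conj {[]}     _ = refl
sum-conj {x ∷ xs} ↘ = begin
  sum (map double (conj (x ∷ xs)))                              ≡⟨ sum-double-stack (conj xs) _ ⟩
  sum (map double (conj xs)) + (length (conj xs) + (x ∸ length (conj xs))) * 2
    ≡⟨ cong₂ (λ a b → a + b * 2) (sum-conj (Linked.tail ↘))
         (trans (sym (length-stack (conj xs) _)) (length-conj ↘)) ⟩
  sum xs * 2 + x * 2                                            ≡⟨ +-comm (sum xs * 2) _ ⟩
  x * 2 + sum xs * 2                                            ≡⟨ *-distribʳ-+ 2 x (sum xs) ⟨
  (x + sum xs) * 2                                              ∎
  where open ≡-Reasoning

-- The length recovers the first row and `stack-injective` the conjugate of the rest. Positivity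
-- rules out trailing zeros, which `conj` does not see.
conj-injective : ∀ {xs ys} → Linked _≥_ xs → All (_> 0) xs → Linked _≥_ ys → All (_> 0) ys →
                 conj xs ≡ conj ys → xs ≡ ys
conj-injective {[]}     {[]}     _ _ _ _ _ = refl
conj-injective {[]}     {y ∷ ys} _ _ ys↘ (y>0 ∷ _) eq =
  contradiction (trans (cong length eq) (length-conj ys↘)) (<⇒≢ y>0)
conj-injective {x ∷ xs} {[]}     xs↘ (x>0 ∷ _) _ _ eq =
  contradiction (trans (cong length (sym eq)) (length-conj xs↘)) (<⇒≢ x>0)
conj-injective {x ∷ xs} {y ∷ ys} xs↘ (_ ∷ xs+) ys↘ (_ ∷ ys+) eq =
  cong₂ _∷_
    (trans (sym (length-conj xs↘)) (trans (cong length eq) (length-conj ys↘)))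
    (conj-injective (Linked.tail xs↘) xs+ (Linked.tail ys↘) ys+
      (proj₁ (stack-injective (conj xs) (conj ys) eq)))

-- The length of `ks` is the first row, and unstacking removes that row. If `ks` has no zero the
-- length stays the same, so the recursion is on the sum of the doubled entries, which falls by
-- twice the length.
conj-surjective : ∀ {ks} → Linked _≥_ ks →
                  ∃[ xs ] Linked _≥_ xs × All (_> 0) xs × conj xs ≡ ks
conj-surjective ↘ = go ↘ (<-wellFounded _)
  where
  go : ∀ {ks} → Linked _≥_ ks → Acc _<_ (sum (map double ks)) →
       ∃[ xs ] Linked _≥_ xs × All (_> 0) xs × conj xs ≡ ks
  go {[]} _ _ = [] , [] , [] , refl
  go {k ∷ ks} ↘ (acc rec) with unstack ↘
  ... | zs , z , eq , zs↘ with go zs↘ (rec smaller)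
    where
    smaller : sum (map double zs) < sum (map double (k ∷ ks))
    smaller = begin-strict
      sum (map double zs)                         <⟨ m<m+n _ (s≤s z≤n) ⟩
      sum (map double zs) + length (k ∷ ks) * 2
        ≡⟨ cong (λ l → sum (map double zs) + l * 2) (trans (cong length (sym eq)) (length-stack zs z)) ⟩
      sum (map double zs) + (length zs + z) * 2   ≡⟨ sum-double-stack zs z ⟨
      sum (map double (stack zs z))               ≡⟨ cong (sum ∘ map double) eq ⟩
      sum (map double (k ∷ ks))                   ∎
      where open ≤-Reasoning
  ... | xs , xs↘ , xs+ , refl =
    length (k ∷ ks) ∷ xs
    , cons≥ (begin
        largest xs         ≡⟨ length-conj xs↘ ⟨
        length zs          ≤⟨ m≤m+n _ z ⟩
        length zs + z      ≡⟨ length≡ ⟨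
        length (k ∷ ks)    ∎) xs↘
    , s≤s z≤n ∷ xs+
    , trans (cong (stack zs) (trans (cong (_∸ length zs) length≡) (m+n∸m≡n (length zs) z))) eq
    where
    open ≤-Reasoning
    length≡ : length (k ∷ ks) ≡ length zs + z
    length≡ = trans (cong length (sym eq)) (length-stack zs z)

-- Sylvester's bijection.

-- The inverse of the hook peeling: k₁ = v − m, and the number of parts 1 is
-- z = u − v − 1; for strictly decreasing positive input nothing is truncated.
sylvester : List ℕ → List ℕ
sylvester []           = []
sylvester (u ∷ [])     = replicate u 0
sylvester (u ∷ v ∷ ws) =
  (v ∸ length (sylvester ws)) ∷ stack (sylvester ws) (u ∸ suc v)

Strict : List ℕ → Set
Strict xs = Linked _>_ xs × All (_> 0) xs

tail-strict : ∀ {x xs} → Strict (x ∷ xs) → Strict xs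
tail-strict (↘ , _ ∷ pos) = Linked.tail ↘ , pos

head-strict : ∀ {x xs} → Strict (x ∷ xs) → largest xs < x
head-strict (↘ , pos) = head> ↘ pos

cons-strict : ∀ {x xs} → largest xs < x → Strict xs → Strict (x ∷ xs)
cons-strict y<x (↘ , pos) = cons> y<x ↘ , ≤-trans (s≤s z≤n) y<x ∷ pos

-- The hook identity u₁ = k₁ + b. It is mutual with the length bound: the bound for `ws` makes
-- `v ∸ l` exact here, and the identity in turn yields the bound.
largest-sylvester : ∀ {us} → Strict us → largest (sylvester us) + length (sylvester us) ≡ largest us
length-sylvester≤ : ∀ {us} → Strict us → length (sylvester us) ≤ largest us

largest-sylvester {[]}         _ = refl
largest-sylvester {zero ∷ []}  _ = refl
largest-sylvester {suc u ∷ []} _ = cong suc (length-replicate u)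
largest-sylvester {u ∷ v ∷ ws} us> = begin
  (v ∸ l) + suc (length (stack (sylvester ws) (u ∸ suc v)))
    ≡⟨ cong (λ m → (v ∸ l) + suc m) (length-stack (sylvester ws) _) ⟩
  (v ∸ l) + suc (l + (u ∸ suc v))   ≡⟨ lemma (v ∸ l) l (u ∸ suc v) ⟩
  suc (v ∸ l + l) + (u ∸ suc v)     ≡⟨ cong (λ m → suc m + (u ∸ suc v)) (m∸n+n≡m l≤v) ⟩
  suc v + (u ∸ suc v)               ≡⟨ m+[n∸m]≡n (head-strict us>) ⟩
  u                                 ∎
  where
  open ≡-Reasoning
  l = length (sylvester ws)
  l≤v : l ≤ v
  l≤v = ≤-trans (length-sylvester≤ (tail-strict (tail-strict us>)))
                (<⇒≤ (head-strict (tail-strict us>)))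
  lemma : ∀ a b c → a + suc (b + c) ≡ suc (a + b) + c
  lemma = solve-∀

length-sylvester≤ us> = ≤-trans (m≤n+m _ _) (≤-reflexive (largest-sylvester us>))

-- Makes k₁ = v - m both exact and positive.
length-sylvester<second : ∀ {v ws} → Strict (v ∷ ws) → length (sylvester ws) < v
length-sylvester<second vs> =
  ≤-<-trans (length-sylvester≤ (tail-strict vs>)) (head-strict vs>)

-- The point is k₁ ≥ k₂. By the hook identity for `ws`, k₂ is at most 1 + `largest ws` - m, and
-- `largest ws` < `v` bounds this by v - m = k₁.
sylvester-↘ : ∀ {us} → Strict us → Linked _≥_ (sylvester us)
sylvester-↘ {[]}         _   = []
sylvester-↘ {u ∷ []}     _   = stack-↘ u []
sylvester-↘ {u ∷ v ∷ ws} us> = cons≥ (begin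
  largest (stack (sylvester ws) (u ∸ suc v))    ≤⟨ largest-stack (sylvester ws) _ ⟩
  suc (largest (sylvester ws))                  ≡⟨ m+n∸n≡m _ (length (sylvester ws)) ⟨
  suc (largest (sylvester ws)) + length (sylvester ws) ∸ length (sylvester ws)
    ≡⟨ cong (λ m → suc m ∸ length (sylvester ws)) (largest-sylvester ws>) ⟩
  suc (largest ws) ∸ length (sylvester ws)
    ≤⟨ ∸-monoˡ-≤ (length (sylvester ws)) (head-strict (tail-strict us>)) ⟩
  v ∸ length (sylvester ws)                     ∎)
  (stack-↘ (u ∸ suc v) (sylvester-↘ ws>))
  where
  open ≤-Reasoning
  ws> = tail-strict (tail-strict us>)

-- By induction `l` is the alternating sum of `ws`, so u - (v - l) = u₁ - k₁, which is b by the hook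
-- identity. The inequalities `l≤v` and `v∸l≤u` let both integer differences be computed as natural
-- numbers.
length-sylvester : ∀ {us} → Strict us → alternatingSum us ≡ ℤ.+ length (sylvester us)
length-sylvester {[]}         _   = refl
length-sylvester {u ∷ []}     _   = trans (ℤ.+-identityʳ (ℤ.+ u)) (cong ℤ.+_ (sym (length-replicate u)))
length-sylvester {u ∷ v ∷ ws} us> = begin
  ℤ.+ u ℤ.- (ℤ.+ v ℤ.- alternatingSum ws)
    ≡⟨ cong (λ i → ℤ.+ u ℤ.- (ℤ.+ v ℤ.- i)) (length-sylvester (tail-strict (tail-strict us>))) ⟩
  ℤ.+ u ℤ.- (ℤ.+ v ℤ.- ℤ.+ l)
    ≡⟨ cong (λ i → ℤ.+ u ℤ.- i) (trans (ℤ.m-n≡m⊖n v l) (ℤ.⊖-≥ l≤v)) ⟩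
  ℤ.+ u ℤ.- ℤ.+ (v ∸ l)                    ≡⟨ trans (ℤ.m-n≡m⊖n u (v ∸ l)) (ℤ.⊖-≥ v∸l≤u) ⟩
  ℤ.+ (u ∸ (v ∸ l))
    ≡⟨ cong (λ m → ℤ.+ (m ∸ (v ∸ l))) (largest-sylvester us>) ⟨
  ℤ.+ ((v ∸ l) + length (sylvester (u ∷ v ∷ ws)) ∸ (v ∸ l))
    ≡⟨ cong ℤ.+_ (m+n∸m≡n (v ∸ l) _) ⟩
  ℤ.+ length (sylvester (u ∷ v ∷ ws))      ∎
  where
  open ≡-Reasoning
  l = length (sylvester ws)
  l≤v : l ≤ v
  l≤v = <⇒≤ (length-sylvester<second (tail-strict us>))
  v∸l≤u : v ∸ l ≤ u
  v∸l≤u = ≤-trans (m∸n≤m v l) (<⇒≤ (head-strict us>))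

-- Raising the `l` entries of `sylvester ws` adds 2l, which compensates the loss in 2(v - l) + 1;
-- with the u - v - 1 ones this leaves u + v.
sum-sylvester : ∀ {us} → Strict us → sum (map odd (sylvester us)) ≡ sum us
sum-sylvester {[]}         _   = refl
sum-sylvester {u ∷ []}     _   = trans (sum-odd-stack [] u) (sym (+-identityʳ u))
sum-sylvester {u ∷ v ∷ ws} us> = begin
  odd (v ∸ l) + sum (map odd (stack (sylvester ws) (u ∸ suc v)))
    ≡⟨ cong (odd (v ∸ l) +_) (sum-odd-stack (sylvester ws) _) ⟩
  odd (v ∸ l) + (sum (map odd (sylvester ws)) + l * 2 + (u ∸ suc v))
    ≡⟨ cong (λ m → odd (v ∸ l) + (m + l * 2 + (u ∸ suc v))) (sum-sylvester (tail-strict (tail-strict us>))) ⟩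
  odd (v ∸ l) + (sum ws + l * 2 + (u ∸ suc v))
    ≡⟨ lemma (v ∸ l) l (sum ws) (u ∸ suc v) ⟩
  suc (v ∸ l + l) + (u ∸ suc v) + (v ∸ l + l + sum ws)
    ≡⟨ cong (λ m → suc m + (u ∸ suc v) + (m + sum ws)) (m∸n+n≡m l≤v) ⟩
  suc v + (u ∸ suc v) + (v + sum ws)
    ≡⟨ cong (_+ (v + sum ws)) (m+[n∸m]≡n (head-strict us>)) ⟩
  u + (v + sum ws)                  ∎
  where
  open ≡-Reasoning
  l = length (sylvester ws)
  l≤v : l ≤ v
  l≤v = <⇒≤ (length-sylvester<second (tail-strict us>))
  lemma : ∀ a b c d → suc (a * 2) + (c + b * 2 + d) ≡ suc (a + b) + d + (a + b + c)
  lemma = solve-∀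

-- The largest part is read off first, as first entry plus length; then `stack-injective` and
-- induction give `ws`, and the first entry gives `v`.
sylvester-injective : ∀ {us vs} → Strict us → Strict vs → sylvester us ≡ sylvester vs → us ≡ vs
sylvester-injective {us} {vs} us> vs> eq = go us> vs> eq
  (trans (sym (largest-sylvester us>))
    (trans (cong (λ ks → largest ks + length ks) eq) (largest-sylvester vs>)))
  where
  go : ∀ {us vs} → Strict us → Strict vs → sylvester us ≡ sylvester vs →
       largest us ≡ largest vs → us ≡ vs
  go {[]}         {[]}         _ _ _ _ = refl
  go {[]}         {v ∷ vs}     _ vs> _ eq = contradiction eq (<⇒≢ (≤-<-trans z≤n (head-strict vs>)))
  go {u ∷ us}     {[]}         us> _ _ eq = contradiction (sym eq) (<⇒≢ (≤-<-trans z≤n (head-strict us>)))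
  go {u ∷ []}     {_ ∷ []}     _ _ _ refl = refl
  -- A single part gives first entry 0, but two or more parts give a positive one.
  go {suc u ∷ []} {_ ∷ v ∷ ws} _ vs> eq refl =
    contradiction (∷-injectiveˡ eq) (<⇒≢ (m<n⇒0<n∸m (length-sylvester<second (tail-strict vs>))))
  go {_ ∷ v ∷ ws} {suc u ∷ []} us> _ eq refl =
    contradiction (sym (∷-injectiveˡ eq)) (<⇒≢ (m<n⇒0<n∸m (length-sylvester<second (tail-strict us>))))
  go {u ∷ v ∷ ws} {_ ∷ v′ ∷ ws′} us> vs> eq refl
    with refl ← sylvester-injective (tail-strict (tail-strict us>)) (tail-strict (tail-strict vs>))
                  (proj₁ (stack-injective (sylvester ws) (sylvester ws′) (∷-injectiveʳ eq)))
    with refl ← ∸-cancelʳ-≡ (<⇒≤ (length-sylvester<second (tail-strict us>)))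
                            (<⇒≤ (length-sylvester<second (tail-strict vs>)))
                            (∷-injectiveˡ eq) = refl

sylvester-surjective : ∀ {ks} → Linked _≥_ ks → ∃[ us ] Strict us × sylvester us ≡ ks
sylvester-surjective ↘ = go ↘ (<-wellFounded _)
  where
  go : ∀ {ks} → Linked _≥_ ks → Acc _<_ (length ks) → ∃[ us ] Strict us × sylvester us ≡ ks
  go ↘ (acc rec) with unstack ↘
  ... | []     , zero  , refl , _   = [] , ([] , []) , refl
  -- All entries are zero, that is, all odd parts are 1; they come from a single distinct part.
  ... | []     , suc z , refl , _   = suc z ∷ [] , ([-] , s≤s z≤n ∷ []) , refl
  ... | k ∷ zs , z     , refl , zs↘
    with go (Linked.tail zs↘) (rec (s≤s (≤-trans (m≤m+n _ z) (≤-reflexive (sym (length-stack zs z))))))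
  ... | ws , ws> , refl =
    suc v + z ∷ v ∷ ws
    , cons-strict (m≤m+n (suc v) z) (cons-strict largest<v ws>)
    , cong₂ (λ k z → k ∷ stack zs z) (m+n∸n≡m (suc k) (length zs)) (m+n∸m≡n (suc v) z)
    where
    -- The first entry of the original list is `suc k`, as unstacking lowered it too, so this is u₂
    -- = k₁ + m; then u₁ = u₂ + 1 + z.
    v = suc k + length zs
    largest<v : largest ws < v
    largest<v = ≤-trans (≤-reflexive (cong suc (sym (largest-sylvester ws>))))
                        (s≤s (+-monoˡ-≤ (length zs) (head≥ zs↘)))

-- Divisibility, permutations and multiplicities.

∣m+n∣n⇒∣m : ∀ {d} m {n} → d ∣ m + n → d ∣ n → d ∣ m
∣m+n∣n⇒∣m {d} m {n} d∣m+n = ∣m+n∣m⇒∣n (subst (d ∣_) (+-comm m n) d∣m+n)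

-- Decreasing lists are canonical forms of multisets, so lists can be compared up to permutation and
-- made equal only at the end.
↘↭↘⇒≡ : ∀ {xs ys} → Linked _≥_ xs → Linked _≥_ ys → xs ↭ ys → xs ≡ ys
↘↭↘⇒≡ xs↘ ys↘ xs↭ys =
  Pointwise-≡⇒≡ (↗↭↗⇒≋ (DecTotalOrder.totalOrder ≥-decTotalOrder) xs↘ ys↘ (↭⇒↭ₛ xs↭ys))

++-cancelˡ-↭ : ∀ {A : Set} (xs : List A) {ys zs} → xs ++ ys ↭ xs ++ zs → ys ↭ zs
++-cancelˡ-↭ []       p = p
++-cancelˡ-↭ (x ∷ xs) p = ++-cancelˡ-↭ xs (drop-∷ p)

filter-↭-∁ : ∀ {A : Set} {P : Pred A 0ℓ} (P? : Decidable P) xs →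
             xs ↭ filter P? xs ++ filter (¬? ∘ P?) xs
filter-↭-∁ P? xs = subst (λ (ys , zs) → xs ↭ ys ++ zs) (partition-defn P? xs)
  (↭ₛ⇒↭ (Permutationₛ.partition-↭ (setoid _) P? xs))

multiplicity-++ : ∀ i xs ys → multiplicity i (xs ++ ys) ≡ multiplicity i xs + multiplicity i ys
multiplicity-++ i xs ys = trans (cong length (filter-++ (i ≟_) xs ys)) (length-++ (filter (i ≟_) xs))

multiplicity-↭ : ∀ i {xs ys} → xs ↭ ys → multiplicity i xs ≡ multiplicity i ys
multiplicity-↭ i = ↭-length ∘ filter-↭ (i ≟_)

∈⇒multiplicity>0 : ∀ {i xs} → i ∈ xs → 0 < multiplicity i xs
∈⇒multiplicity>0 {i} i∈xs = ∈-length (∈-filter⁺ (i ≟_) i∈xs refl)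

multiplicity>0⇒∈ : ∀ {i} xs → 0 < multiplicity i xs → i ∈ xs
multiplicity>0⇒∈ {i} xs m>0 with filter (i ≟_) xs in eq
... | z ∷ _ with z∈xs , refl ← ∈-filter⁻ (i ≟_) {xs = xs} (subst (z ∈_) (sym eq) (here refl)) = z∈xs

unique⇒multiplicity≤1 : ∀ i {xs} → Unique xs → multiplicity i xs ≤ 1
unique⇒multiplicity≤1 i []           = z≤n
unique⇒multiplicity≤1 i {x ∷ xs} (x∉ ∷ xs!) with i ≟ x
... | yes refl = ≤-reflexive (cong length
  (trans (filter-accept (i ≟_) refl) (cong (i ∷_) (filter-none (i ≟_) x∉))))
... | no  i≢x  =
  ≤-trans (≤-reflexive (cong length (filter-reject (i ≟_) i≢x))) (unique⇒multiplicity≤1 i xs!)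

↘-unique : ∀ {xs} → Linked _>_ xs → Unique xs
↘-unique = AllPairs.map >⇒≢ ∘ Linked.Linked⇒AllPairs (λ x>y y>z → <-trans y>z x>y)

bounded⇒largest≤ : ∀ {x xs} → All (x ≥_) xs → largest xs ≤ x
bounded⇒largest≤ []        = z≤n
bounded⇒largest≤ (x≥y ∷ _) = x≥y

-- Pairing equal parts.

duplicate : List ℕ → List ℕ
duplicate []       = []
duplicate (x ∷ xs) = x ∷ x ∷ duplicate xs

duplicate-↘ : ∀ {xs} → Linked _≥_ xs → Linked _≥_ (duplicate xs)
duplicate-↘ []        = []
duplicate-↘ [-]       = ≤-refl ∷ [-]
duplicate-↘ (x≥y ∷ ↘) = ≤-refl ∷ x≥y ∷ duplicate-↘ ↘

duplicate-injective : ∀ {xs ys} → duplicate xs ≡ duplicate ys → xs ≡ ys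
duplicate-injective {[]}     {[]}     _  = refl
duplicate-injective {x ∷ xs} {y ∷ ys} eq =
  cong₂ _∷_ (∷-injectiveˡ eq) (duplicate-injective (∷-injectiveʳ (∷-injectiveʳ eq)))

duplicate-All⁺ : ∀ {P : Pred ℕ 0ℓ} {xs} → All P xs → All P (duplicate xs)
duplicate-All⁺ []         = []
duplicate-All⁺ (px ∷ pxs) = px ∷ px ∷ duplicate-All⁺ pxs

duplicate-All⁻ : ∀ {P : Pred ℕ 0ℓ} xs → All P (duplicate xs) → All P xs
duplicate-All⁻ []       _              = []
duplicate-All⁻ (x ∷ xs) (px ∷ _ ∷ pxs) = px ∷ duplicate-All⁻ xs pxs

sum-duplicate : ∀ xs → sum (duplicate xs) ≡ sum xs * 2
sum-duplicate []       = refl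
sum-duplicate (x ∷ xs) = trans (cong (λ m → x + (x + m)) (sum-duplicate xs)) (lemma x (sum xs))
  where
  lemma : ∀ a b → a + (a + b * 2) ≡ (a + b) * 2
  lemma = solve-∀

multiplicity-duplicate : ∀ i xs → multiplicity i (duplicate xs) ≡ multiplicity i xs * 2
multiplicity-duplicate i []       = refl
multiplicity-duplicate i (x ∷ xs) = begin
  multiplicity i (x ∷ x ∷ duplicate xs)
    ≡⟨ multiplicity-++ i [x] (x ∷ duplicate xs) ⟩
  multiplicity i [x] + multiplicity i (x ∷ duplicate xs)
    ≡⟨ cong (multiplicity i [x] +_) (multiplicity-++ i [x] (duplicate xs)) ⟩
  multiplicity i [x] + (multiplicity i [x] + multiplicity i (duplicate xs))
    ≡⟨ cong (λ m → multiplicity i [x] + (multiplicity i [x] + m)) (multiplicity-duplicate i xs) ⟩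
  multiplicity i [x] + (multiplicity i [x] + multiplicity i xs * 2)
    ≡⟨ lemma (multiplicity i [x]) (multiplicity i xs) ⟩
  (multiplicity i [x] + multiplicity i xs) * 2
    ≡⟨ cong (_* 2) (multiplicity-++ i [x] xs) ⟨
  multiplicity i (x ∷ xs) * 2   ∎
  where
  open ≡-Reasoning
  [x] = x ∷ []
  lemma : ∀ a b → a + (a + b * 2) ≡ (a + b) * 2
  lemma = solve-∀

-- The decomposition λ = μ ∪ μ ∪ ν with `paired` = μ and `unpaired` = ν. For decreasing `xs` it is
-- unique, as the proof of `corresponds-functional` shows.
record Pairing (xs : List ℕ) : Set where
  field
    {paired unpaired} : List ℕ
    paired-↘          : Linked _≥_ paired
    paired-positive   : All (_> 0) paired
    unpaired-strict   : Strict unpaired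
    pairing           : xs ↭ unpaired ++ duplicate paired

module _ {xs : List ℕ} (xs↘ : Linked _≥_ xs) (p : Pairing xs) where
  open Pairing p

  private
    -- As `unpaired` has no repetitions, this is division by 2: the multiplicity in `unpaired` is
    -- the remainder and that in `paired` the quotient.
    multiplicity-pairing : ∀ i → multiplicity i xs ≡ multiplicity i unpaired + multiplicity i paired * 2
    multiplicity-pairing i = begin
      multiplicity i xs                                         ≡⟨ multiplicity-↭ i pairing ⟩
      multiplicity i (unpaired ++ duplicate paired)             ≡⟨ multiplicity-++ i unpaired _ ⟩
      multiplicity i unpaired + multiplicity i (duplicate paired)
        ≡⟨ cong (multiplicity i unpaired +_) (multiplicity-duplicate i paired) ⟩
      multiplicity i unpaired + multiplicity i paired * 2       ∎
      where open ≡-Reasoning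

    unpaired-! : Unique unpaired
    unpaired-! = ↘-unique (proj₁ unpaired-strict)

    repeated⇒∈paired : ∀ {i} → 2 ≤ multiplicity i xs → i ∈ paired
    repeated⇒∈paired {i} 2≤m = multiplicity>0⇒∈ paired (n≢0⇒n>0 λ none →
      contradiction
        (≤-trans 2≤m (≤-trans (≤-reflexive (multiplicity-pairing i))
          (subst (λ m → multiplicity i unpaired + m * 2 ≤ 1) (sym none)
            (≤-trans (≤-reflexive (+-identityʳ _)) (unique⇒multiplicity≤1 i unpaired-!)))))
        λ { (s≤s ()) })

    ∈paired⇒repeated : ∀ {i} → i ∈ paired → 2 ≤ multiplicity i xs
    ∈paired⇒repeated {i} i∈ = begin
      2                                                     ≤⟨ *-monoˡ-≤ 2 (∈⇒multiplicity>0 i∈) ⟩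
      multiplicity i paired * 2                             ≤⟨ m≤n+m _ _ ⟩
      multiplicity i unpaired + multiplicity i paired * 2   ≡⟨ multiplicity-pairing i ⟨
      multiplicity i xs                                     ∎
      where open ≤-Reasoning

    ∈unpaired⇒odd : ∀ {i} → i ∈ unpaired → ¬ 2 ∣ multiplicity i xs
    ∈unpaired⇒odd {i} i∈ 2∣m with () ← ∣1⇒≡1 (subst (2 ∣_)
      (≤-antisym (unique⇒multiplicity≤1 i unpaired-!) (∈⇒multiplicity>0 i∈))
      (∣m+n∣n⇒∣m (multiplicity i unpaired) (subst (2 ∣_) (multiplicity-pairing i) 2∣m) (n∣m*n (multiplicity i paired))))

    odd⇒∈unpaired : ∀ {i} → ¬ 2 ∣ multiplicity i xs → i ∈ unpaired
    odd⇒∈unpaired {i} 2∤m = multiplicity>0⇒∈ unpaired (n≢0⇒n>0 λ none →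
      2∤m (divides (multiplicity i paired)
        (trans (multiplicity-pairing i) (cong (_+ multiplicity i paired * 2) none))))

  -- Both lists are duplicate-free with the same members, the sizes of odd multiplicity, hence
  -- permutations of each other; both decrease, so they agree.
  unpairedParts≡unpaired : unpairedParts xs ≡ unpaired
  unpairedParts≡unpaired = ↘↭↘⇒≡
    (Linked.filter⁺ odd? ≥-trans (deduplicate-↘ xs↘))
    (Linked.map <⇒≤ (proj₁ unpaired-strict))
    (∼bag⇒↭ (unique∧set⇒bag
      (AllPairs.filter⁺ odd? (deduplicate-! _≟_ xs)) unpaired-!
      (mk⇔ (λ i∈ → odd⇒∈unpaired (proj₂ (∈-filter⁻ odd? {xs = deduplicate _≟_ xs} i∈)))
           (λ i∈ → ∈-filter⁺ odd? (∈-deduplicate⁺ _≟_ (∈unpaired⇒∈ i∈)) (∈unpaired⇒odd i∈)))))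
    where
    odd? : Decidable (λ i → ¬ 2 ∣ multiplicity i xs)
    odd? i = ¬? (2 ∣? multiplicity i xs)
    deduplicate-↘ : ∀ {ys} → Linked _≥_ ys → Linked _≥_ (deduplicate _≟_ ys)
    deduplicate-↘ {[]}     _   = []
    deduplicate-↘ {y ∷ ys} ys↘ with _ ∷ y≥ ← Linked.Linked⇒All ≥-trans ≤-refl ys↘ =
      cons≥ (bounded⇒largest≤ (All.filter⁺ (¬? ∘ (y ≟_)) (All.deduplicate⁺ _≟_ y≥)))
            (Linked.filter⁺ (¬? ∘ (y ≟_)) ≥-trans (deduplicate-↘ (Linked.tail ys↘)))
    ∈unpaired⇒∈ : ∀ {i} → i ∈ unpaired → i ∈ xs
    ∈unpaired⇒∈ {i} i∈ = multiplicity>0⇒∈ xs (≤-trans (∈⇒multiplicity>0 i∈)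
      (≤-trans (m≤m+n _ _) (≤-reflexive (sym (multiplicity-pairing i)))))

  -- A size is repeated in `xs` exactly when it lies in `paired`, and both sides are 0 when there is
  -- none.
  max-repeatedParts : max 0 (repeatedParts xs) ≡ largest paired
  max-repeatedParts = ≤-antisym
    (max≤v⁺ z≤n (All.tabulate λ i∈ →
      ∈⇒≤largest paired-↘ (repeated⇒∈paired (proj₂ (∈-filter⁻ repeated? {xs = xs} i∈)))))
    (largest≤max paired (∈⇒∈repeated))
    where
    repeated? : Decidable (λ i → 2 ≤ multiplicity i xs)
    repeated? i = 2 ≤? multiplicity i xs
    ∈⇒≤largest : ∀ {i ys} → Linked _≥_ ys → i ∈ ys → i ≤ largest ys
    ∈⇒≤largest {ys = _ ∷ _} ys↘ = All.lookup (Linked.Linked⇒All ≥-trans ≤-refl ys↘)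
    ∈⇒∈repeated : ∀ {i} → i ∈ paired → i ∈ repeatedParts xs
    ∈⇒∈repeated {i} i∈ = ∈-filter⁺ repeated?
      (multiplicity>0⇒∈ xs (≤-trans (s≤s z≤n) (∈paired⇒repeated i∈))) (∈paired⇒repeated i∈)
    largest≤max : ∀ ys → (∀ {i} → i ∈ ys → i ∈ repeatedParts xs) → largest ys ≤ max 0 (repeatedParts xs)
    largest≤max []       _   = z≤n
    largest≤max (y ∷ ys) inc = v≤max⁺ 0 _ (inj₂ (Any.map ≤-reflexive (inc (here refl))))

-- Parts are added from the smallest up. The new part `x` bounds all others, so it either equals the
-- head of ν and forms a pair with it, or becomes the new head of ν.
pair : ∀ {xs} → Linked _≥_ xs → All (_> 0) xs → Pairing xs
pair {[]} _ _ = record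
  { paired-↘ = [] ; paired-positive = [] ; unpaired-strict = [] , [] ; pairing = ↭-refl }
pair {x ∷ xs} ↘ (x>0 ∷ xs+) with pair (Linked.tail ↘) xs+
... | record { paired = μ ; unpaired = ν ; paired-↘ = μ↘ ; paired-positive = μ+
             ; unpaired-strict = ν> ; pairing = σ } = add ν ν> σ
  where
  x≥ : All (x ≥_) xs
  x≥ = All.tail (Linked.Linked⇒All ≥-trans ≤-refl ↘)
  add : ∀ ν → Strict ν → xs ↭ ν ++ duplicate μ → Pairing (x ∷ xs)
  add [] _ σ = record
    { paired-↘ = μ↘ ; paired-positive = μ+ ; unpaired-strict = [-] , x>0 ∷ [] ; pairing = prep x σ }
  add (y ∷ ν) ν> σ with All-resp-↭ σ x≥ | x ≟ y
  ... | _ ∷ x≥′ | yes refl = record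
    { paired-↘ = cons≥ (bounded⇒largest≤ (duplicate-All⁻ μ (All.++⁻ʳ ν x≥′))) μ↘
    ; paired-positive = x>0 ∷ μ+
    ; unpaired-strict = tail-strict ν>
    ; pairing = ↭-trans (prep x (↭-trans σ (↭-sym (shift x ν (duplicate μ)))))
                        (↭-sym (shift x ν (x ∷ duplicate μ))) }
  ... | x≥y ∷ _ | no x≢y = record
    { paired-↘ = μ↘ ; paired-positive = μ+
    ; unpaired-strict = cons-strict (≤∧≢⇒< x≥y (x≢y ∘ sym)) ν>
    ; pairing = prep x σ }

-- The correspondence and its parity classes.

-- The bijection as a relation up to reordering; its inverse laws then reduce to the relation being
-- functional and injective.
record Corresponds (xs ys : List ℕ) : Set where
  field
    pairings : Pairing xs
  open Pairing pairings public
  field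
    image : ys ↭ map double (conj paired) ++ map odd (sylvester unpaired)

double-even : ∀ ks → All (2 ∣_) (map double ks)
double-even ks = All.map⁺ (All.universal (λ k → n∣m*n (suc k)) ks)

odd-odd : ∀ k → ¬ 2 ∣ odd k
odd-odd k 2∣ with () ← ∣1⇒≡1 (∣m+n∣n⇒∣m 1 2∣ (n∣m*n k))

odds-odd : ∀ ks → All (λ i → ¬ 2 ∣ i) (map odd ks)
odds-odd ks = All.map⁺ (All.universal odd-odd ks)

filter-even : ∀ {ys} es os → ys ↭ map double es ++ map odd os → filter (2 ∣?_) ys ↭ map double es
filter-even es os σ = ↭-trans (filter-↭ (2 ∣?_) σ) (↭-reflexive (begin
  filter (2 ∣?_) (map double es ++ map odd os)
    ≡⟨ filter-++ (2 ∣?_) (map double es) (map odd os) ⟩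
  filter (2 ∣?_) (map double es) ++ filter (2 ∣?_) (map odd os)
    ≡⟨ cong₂ _++_ (filter-all (2 ∣?_) (double-even es)) (filter-none (2 ∣?_) (odds-odd os)) ⟩
  map double es ++ []                ≡⟨ ++-identityʳ _ ⟩
  map double es                      ∎))
  where open ≡-Reasoning

filter-odd : ∀ {ys} es os → ys ↭ map double es ++ map odd os → filter (¬? ∘ (2 ∣?_)) ys ↭ map odd os
filter-odd es os σ = ↭-trans (filter-↭ (¬? ∘ (2 ∣?_)) σ) (↭-reflexive (begin
  filter (¬? ∘ (2 ∣?_)) (map double es ++ map odd os)
    ≡⟨ filter-++ (¬? ∘ (2 ∣?_)) (map double es) (map odd os) ⟩
  filter (¬? ∘ (2 ∣?_)) (map double es) ++ filter (¬? ∘ (2 ∣?_)) (map odd os)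
    ≡⟨ cong₂ _++_ (filter-none (¬? ∘ (2 ∣?_)) (All.map (λ p ¬p → ¬p p) (double-even es)))
                  (filter-all (¬? ∘ (2 ∣?_)) (odds-odd os)) ⟩
  map odd os                         ∎))
  where open ≡-Reasoning

double-mono : ∀ {j k} → j ≤ k → double j ≤ double k
double-mono = *-monoˡ-≤ 2 ∘ s≤s

double-cancel : ∀ {j k} → double j ≤ double k → j ≤ k
double-cancel {j} {k} = s≤s⁻¹ ∘ *-cancelʳ-≤ (suc j) (suc k) 2

double-injective : ∀ {j k} → double j ≡ double k → j ≡ k
double-injective {j} {k} = suc-injective ∘ *-cancelʳ-≡ (suc j) (suc k) 2

odd-cancel : ∀ {j k} → odd j ≤ odd k → j ≤ k
odd-cancel {j} {k} = *-cancelʳ-≤ j k 2 ∘ s≤s⁻¹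

odd-injective : ∀ {j k} → odd j ≡ odd k → j ≡ k
odd-injective {j} {k} = *-cancelʳ-≡ j k 2 ∘ suc-injective

map-double-↘ : ∀ {ks} → Linked _≥_ ks → Linked _≥_ (map double ks)
map-double-↘ = Linked.map⁺ ∘ Linked.map double-mono

map-odd-↘ : ∀ {ks} → Linked _≥_ ks → Linked _≥_ (map odd ks)
map-odd-↘ = Linked.map⁺ ∘ Linked.map (s≤s ∘ *-monoˡ-≤ 2)

even⇒double : ∀ {ys} → All (_> 0) ys → All (2 ∣_) ys → ∃[ ks ] map double ks ≡ ys
even⇒double []        []                       = [] , refl
-- The even number 0 is no value of `double`; positivity excludes it.
even⇒double (() ∷ _)  (divides zero refl ∷ _)
even⇒double (_ ∷ ys+) (divides (suc k) refl ∷ ys∣) with even⇒double ys+ ys∣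
... | ks , refl = k ∷ ks , refl

half-odd : ∀ n → ¬ 2 ∣ n → ∃[ k ] odd k ≡ n
half-odd zero          2∤n = contradiction (divides 0 refl) 2∤n
half-odd (suc zero)    _   = 0 , refl
half-odd (suc (suc n)) 2∤n with half-odd n (λ { (divides q refl) → 2∤n (divides (suc q) refl) })
... | k , refl = suc k , refl

odd⇒odd : ∀ {ys} → All (λ i → ¬ 2 ∣ i) ys → ∃[ ks ] map odd ks ≡ ys
odd⇒odd []           = [] , refl
odd⇒odd (2∤y ∷ 2∤ys) with half-odd _ 2∤y | odd⇒odd 2∤ys
... | k , refl | ks , refl = k ∷ ks , refl

-- Preservation of the sum and transport of r and s.

module _ {xs ys : List ℕ} (c : Corresponds xs ys) where
  open Corresponds c

  sum-corresponds : sum xs ≡ sum ys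
  sum-corresponds = begin
    sum xs                                    ≡⟨ sum-↭ pairing ⟩
    sum (unpaired ++ duplicate paired)        ≡⟨ sum-++ unpaired _ ⟩
    sum unpaired + sum (duplicate paired)     ≡⟨ +-comm (sum unpaired) _ ⟩
    sum (duplicate paired) + sum unpaired
      ≡⟨ cong₂ _+_ (trans (sum-duplicate paired) (sym (sum-conj paired-↘)))
                   (sym (sum-sylvester unpaired-strict)) ⟩
    sum (map double (conj paired)) + sum (map odd (sylvester unpaired))
      ≡⟨ sum-++ (map double (conj paired)) _ ⟨
    sum (map double (conj paired) ++ map odd (sylvester unpaired))   ≡⟨ sum-↭ image ⟨
    sum ys                                    ∎
    where open ≡-Reasoning

  max-repeatedParts≡#even : Linked _≥_ xs → max 0 (repeatedParts xs) ≡ length (filter (2 ∣?_) ys)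
  max-repeatedParts≡#even xs↘ = begin
    max 0 (repeatedParts xs)              ≡⟨ max-repeatedParts xs↘ pairings ⟩
    largest paired                        ≡⟨ length-conj paired-↘ ⟨
    length (conj paired)                  ≡⟨ length-map double (conj paired) ⟨
    length (map double (conj paired))     ≡⟨ ↭-length (filter-even (conj paired) (sylvester unpaired) image) ⟨
    length (filter (2 ∣?_) ys)            ∎
    where open ≡-Reasoning

  alternatingSum≡#odd : Linked _≥_ xs →
    alternatingSum (unpairedParts xs) ≡ ℤ.+ length (filter (¬? ∘ (2 ∣?_)) ys)
  alternatingSum≡#odd xs↘ = begin
    alternatingSum (unpairedParts xs)              ≡⟨ cong alternatingSum (unpairedParts≡unpaired xs↘ pairings) ⟩
    alternatingSum unpaired                        ≡⟨ length-sylvester unpaired-strict ⟩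
    ℤ.+ length (sylvester unpaired)                ≡⟨ cong ℤ.+_ (length-map odd (sylvester unpaired)) ⟨
    ℤ.+ length (map odd (sylvester unpaired))
      ≡⟨ cong ℤ.+_ (↭-length (filter-odd (conj paired) (sylvester unpaired) image)) ⟨
    ℤ.+ length (filter (¬? ∘ (2 ∣?_)) ys)          ∎
    where open ≡-Reasoning

-- Bijectivity of the correspondence.

-- `xs` determines `unpaired` as `unpairedParts xs`; cancelling it leaves `duplicate paired`, which
-- determines `paired`.
corresponds-functional : ∀ {xs ys ys′} → Linked _≥_ xs → Linked _≥_ ys → Linked _≥_ ys′ →
                         Corresponds xs ys → Corresponds xs ys′ → ys ≡ ys′
corresponds-functional {xs} xs↘ ys↘ ys′↘ c c′ = ↘↭↘⇒≡ ys↘ ys′↘ (↭-trans image (↭-trans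
  (↭-reflexive (cong₂ (λ μ ν → map double (conj μ) ++ map odd (sylvester ν)) paired≡ unpaired≡))
  (↭-sym c′.image)))
  where
  open Corresponds c
  module c′ = Corresponds c′
  unpaired≡ : unpaired ≡ c′.unpaired
  unpaired≡ = trans (sym (unpairedParts≡unpaired xs↘ pairings)) (unpairedParts≡unpaired xs↘ c′.pairings)
  paired≡ : paired ≡ c′.paired
  paired≡ = duplicate-injective (↘↭↘⇒≡ (duplicate-↘ paired-↘) (duplicate-↘ c′.paired-↘)
    (++-cancelˡ-↭ unpaired (↭-trans (↭-sym pairing) (↭-trans c′.pairing
      (↭-reflexive (cong (_++ duplicate c′.paired) (sym unpaired≡)))))))

-- The even parts of `ys` determine `conj paired` and the odd parts `sylvester unpaired`, and both
-- maps are injective.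
corresponds-injective : ∀ {xs xs′ ys} → Linked _≥_ xs → Linked _≥_ xs′ →
                        Corresponds xs ys → Corresponds xs′ ys → xs ≡ xs′
corresponds-injective xs↘ xs′↘ c c′ = ↘↭↘⇒≡ xs↘ xs′↘ (↭-trans pairing (↭-trans
  (↭-reflexive (cong₂ (λ μ ν → ν ++ duplicate μ) paired≡ unpaired≡))
  (↭-sym c′.pairing)))
  where
  open Corresponds c
  module c′ = Corresponds c′
  paired≡ : paired ≡ c′.paired
  paired≡ = conj-injective paired-↘ paired-positive c′.paired-↘ c′.paired-positive
    (map-injective double-injective (↘↭↘⇒≡
      (map-double-↘ (conj-↘ paired)) (map-double-↘ (conj-↘ c′.paired))
      (↭-trans (↭-sym (filter-even (conj paired) (sylvester unpaired) image))
               (filter-even (conj c′.paired) (sylvester c′.unpaired) c′.image))))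
  unpaired≡ : unpaired ≡ c′.unpaired
  unpaired≡ = sylvester-injective unpaired-strict c′.unpaired-strict
    (map-injective odd-injective (↘↭↘⇒≡
      (map-odd-↘ (sylvester-↘ unpaired-strict)) (map-odd-↘ (sylvester-↘ c′.unpaired-strict))
      (↭-trans (↭-sym (filter-odd (conj paired) (sylvester unpaired) image))
               (filter-odd (conj c′.paired) (sylvester c′.unpaired) c′.image))))

corresponds-total : ∀ {xs} → Linked _≥_ xs → All (_> 0) xs →
                    ∃[ ys ] Linked _≥_ ys × All (_> 0) ys × Corresponds xs ys
corresponds-total xs↘ xs+ =
  sort zs , sort-↗ zs
  , All-resp-↭ (↭-sym (sort-↭ zs))
      (All.++⁺ (All.map⁺ (All.universal (λ _ → s≤s z≤n) (conj paired)))
               (All.map⁺ (All.universal (λ _ → s≤s z≤n) (sylvester unpaired))))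
  , record { pairings = pair xs↘ xs+ ; image = sort-↭ zs }
  where
  open Pairing (pair xs↘ xs+)
  zs = map double (conj paired) ++ map odd (sylvester unpaired)

-- Split `ys` by parity, decode both halves, invert `conj` and `sylvester`, and merge the results by
-- sorting.
corresponds-surjective : ∀ {ys} → Linked _≥_ ys → All (_> 0) ys →
                         ∃[ xs ] Linked _≥_ xs × All (_> 0) xs × Corresponds xs ys
corresponds-surjective {ys} ys↘ ys+
  with ks , es≡ ← even⇒double (All.filter⁺ (2 ∣?_) ys+) (All.all-filter (2 ∣?_) ys)
     | ls , os≡ ← odd⇒odd (All.all-filter (¬? ∘ (2 ∣?_)) ys)
  with μ , μ↘ , μ+ , refl ← conj-surjective (Linked.map double-cancel (Linked.map⁻
         (subst (Linked _≥_) (sym es≡) (Linked.filter⁺ (2 ∣?_) ≥-trans ys↘))))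
     | ν , ν> , refl ← sylvester-surjective (Linked.map odd-cancel (Linked.map⁻
         (subst (Linked _≥_) (sym os≡) (Linked.filter⁺ (¬? ∘ (2 ∣?_)) ≥-trans ys↘))))
  = sort (ν ++ duplicate μ) , sort-↗ (ν ++ duplicate μ)
  , All-resp-↭ (↭-sym (sort-↭ (ν ++ duplicate μ))) (All.++⁺ (proj₂ ν>) (duplicate-All⁺ μ+))
  , record
    { pairings = record
      { paired-↘ = μ↘ ; paired-positive = μ+ ; unpaired-strict = ν> ; pairing = sort-↭ (ν ++ duplicate μ) }
    ; image = ↭-trans (filter-↭-∁ (2 ∣?_) ys) (↭-reflexive (sym (cong₂ _++_ es≡ os≡)))
    }

-- Finiteness.

Σ-irrelevant-≡ : ∀ {A : Set} {P : Pred A 0ℓ} → Irrelevant P → {p q : Σ A P} → proj₁ p ≡ proj₁ q → p ≡ q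
Σ-irrelevant-≡ irr {_ , p} {_ , q} refl = cong (_ ,_) (irr p q)

-- An element is numbered by its position in the duplicate-free list of all `x` satisfying `P`;
-- irrelevance of `P` makes the position determine the pair.
listed⇒finite : ∀ {A : Set} {P : Pred A 0ℓ} → DecidableEquality A → Decidable P → Irrelevant P →
                (xs : List A) → (∀ {x} → P x → x ∈ xs) → ∃[ k ] HasCardinality (Σ A P) k
listed⇒finite {A} {P} _≟_ P? irr xs complete = length ys , mk↔ₛ′ to from to∘from from∘to
  where
  ys : List A
  ys = filter P? (deduplicate _≟_ xs)

  P⇒∈ys : ∀ {x} → P x → x ∈ ys
  P⇒∈ys px = ∈-filter⁺ P? (∈-deduplicate⁺ _≟_ (complete px)) px

  to : Σ A P → Fin (length ys)
  to (_ , px) = Any.index (P⇒∈ys px)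

  from : Fin (length ys) → Σ A P
  from i = lookup ys i , All.lookup (All.all-filter P? (deduplicate _≟_ xs)) (∈-lookup i)

  index-lookup : ∀ (zs : List A) i → Any.index (∈-lookup {xs = zs} i) ≡ i
  index-lookup (_ ∷ _)  Fin.zero    = refl
  index-lookup (_ ∷ zs) (Fin.suc i) = cong Fin.suc (index-lookup zs i)

  to∘from : ∀ i → to (from i) ≡ i
  to∘from i = trans
    -- In a duplicate-free list membership proofs are unique, so the one built from completeness is
    -- the canonical one at position `i`.
    (cong Any.index (unique⇒irrelevant (AllPairs.filter⁺ P? (deduplicate-! _≟_ xs)) _ (∈-lookup i)))
    (index-lookup ys i)

  from∘to : ∀ p → from (to p) ≡ p
  from∘to (_ , px) = Σ-irrelevant-≡ irr (sym (lookup-index (P⇒∈ys px)))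

-- A crude superset of the lists of positive parts with sum at most `n`. A positive part lowers the
-- remaining sum by at least 1, so the bound may fall by 1 per entry; `upTo (2 + n)` ends at
-- `suc n`.
boundedLists : ℕ → List (List ℕ)
boundedLists zero    = [] ∷ []
boundedLists (suc n) = [] ∷ cartesianProductWith _∷_ (upTo (2 + n)) (boundedLists n)

∈-boundedLists : ∀ {n xs} → All (_> 0) xs → sum xs ≤ n → xs ∈ boundedLists n
∈-boundedLists {zero}  []        _ = here refl
∈-boundedLists {suc n} []        _ = here refl
∈-boundedLists {zero}  {suc x ∷ xs} (_ ∷ _) ()
∈-boundedLists {suc n} {suc x ∷ xs} (_ ∷ xs+) (s≤s x+Σ≤n) = there (∈-cartesianProductWith⁺ _∷_
  (∈-upTo⁺ (s≤s (s≤s (≤-trans (m≤m+n x (sum xs)) x+Σ≤n))))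
  (∈-boundedLists xs+ (≤-trans (m≤n+m (sum xs) x) x+Σ≤n)))

partition-≡ : ∀ {n} {p q : Partition n} → parts p ≡ parts q → p ≡ q
partition-≡ {p = mkPartition _ d₁ p₁ s₁} {mkPartition _ d₂ p₂ s₂} refl
  with refl ← Linked.irrelevant ≤-irrelevant d₁ d₂
     | refl ← All.irrelevant ≤-irrelevant p₁ p₂
     | refl ← ≡-irrelevant s₁ s₂ = refl

-- Only the parity side is enumerated; the other side inherits its cardinality through
-- `pairing↔parity`.
refined-finite : ∀ n a b →
  ∃[ k ] HasCardinality (Σ[ p ∈ Partition n ] (#evenParts p ≡ a × #oddParts p ≡ b)) k
refined-finite n a b with listed⇒finite {P = Refined} (≡-dec _≟_) refined? refined-irrelevant
                            (boundedLists n) (λ (_ , xs+ , Σ≡n , _) → ∈-boundedLists xs+ (≤-reflexive Σ≡n))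
  where
  Refined : List ℕ → Set
  Refined xs = Linked _≥_ xs × All (_> 0) xs × sum xs ≡ n
             × length (filter (2 ∣?_) xs) ≡ a × length (filter (¬? ∘ (2 ∣?_)) xs) ≡ b

  refined? : Decidable Refined
  refined? xs = Linked.linked? _≥?_ xs ×-dec All.all? (_>? 0) xs ×-dec (sum xs ≟ n)
    ×-dec (length (filter (2 ∣?_) xs) ≟ a) ×-dec (length (filter (¬? ∘ (2 ∣?_)) xs) ≟ b)

  refined-irrelevant : Irrelevant Refined
  refined-irrelevant (d , p , t , e , o) (d′ , p′ , t′ , e′ , o′)
    with refl ← Linked.irrelevant ≤-irrelevant d d′
       | refl ← All.irrelevant ≤-irrelevant p p′
       | refl ← ≡-irrelevant t t′ | refl ← ≡-irrelevant e e′ | refl ← ≡-irrelevant o o′ = refl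
... | k , fin = k , ↔-trans (mk↔ₛ′
  (λ (mkPartition xs d p t , e , o) → xs , d , p , t , e , o)
  (λ (xs , d , p , t , e , o) → mkPartition xs d p t , e , o)
  (λ _ → refl) (λ _ → refl)) fin

-- The bijection between the two refined sets.

pairing↔parity : ∀ n a b →
  (Σ[ p ∈ Partition n ] (r p ≡ a × s p ≡ ℤ.+ b)) ↔
  (Σ[ p ∈ Partition n ] (#evenParts p ≡ a × #oddParts p ≡ b))
pairing↔parity n a b = mk↔ₛ′ to from to∘from from∘to
  where
  LHS = Σ[ p ∈ Partition n ] (r p ≡ a × s p ≡ ℤ.+ b)
  RHS = Σ[ p ∈ Partition n ] (#evenParts p ≡ a × #oddParts p ≡ b)

  -- The correspondence travels with the image, so the inverse laws never unfold the construction.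
  image-of : (p : LHS) → Σ[ q ∈ RHS ] Corresponds (parts (proj₁ p)) (parts (proj₁ q))
  image-of (mkPartition xs xs↘ xs+ Σ≡ , r≡ , s≡)
    with ys , ys↘ , ys+ , c ← corresponds-total xs↘ xs+ =
    ( mkPartition ys ys↘ ys+ (trans (sym (sum-corresponds c)) Σ≡)
    , trans (sym (max-repeatedParts≡#even c xs↘)) r≡
    , ℤ.+-injective (trans (sym (alternatingSum≡#odd c xs↘)) s≡)) , c

  preimage-of : (q : RHS) → Σ[ p ∈ LHS ] Corresponds (parts (proj₁ p)) (parts (proj₁ q))
  preimage-of (mkPartition ys ys↘ ys+ Σ≡ , e≡ , o≡)
    with xs , xs↘ , xs+ , c ← corresponds-surjective ys↘ ys+ =
    ( mkPartition xs xs↘ xs+ (trans (sum-corresponds c) Σ≡)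
    , trans (max-repeatedParts≡#even c xs↘) e≡
    , trans (alternatingSum≡#odd c xs↘) (cong ℤ.+_ o≡)) , c

  to : LHS → RHS
  to = proj₁ ∘ image-of

  from : RHS → LHS
  from = proj₁ ∘ preimage-of

  to∘from : ∀ q → to (from q) ≡ q
  to∘from q@(q′ , _) = Σ-irrelevant-≡
    (λ (e , o) (e′ , o′) → cong₂ _,_ (≡-irrelevant e e′) (≡-irrelevant o o′))
    -- Both `to (from q)` and `q` correspond to `from q`.
    (partition-≡ (corresponds-functional (decreasing (proj₁ (from q))) (decreasing (proj₁ (to (from q))))
      (decreasing q′) (proj₂ (image-of (from q))) (proj₂ (preimage-of q))))

  from∘to : ∀ p → from (to p) ≡ p
  from∘to p@(p′ , _) = Σ-irrelevant-≡
    (λ (e , o) (e′ , o′) → cong₂ _,_ (≡-irrelevant e e′) (Decidable⇒UIP.≡-irrelevant ℤ._≟_ o o′))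
    -- Both `from (to p)` and `p` have `to p` as their image.
    (partition-≡ (corresponds-injective (decreasing (proj₁ (from (to p)))) (decreasing p′)
      (proj₂ (preimage-of (to p))) (proj₂ (image-of p))))

open import Data.Integer.Base using (+_)

theorem2p3 : (n a b : ℕ) →
    ∃[ k ] (HasCardinality (Σ[ p ∈ Partition n ] (r p ≡ a × s p ≡ + b)) k
    × HasCardinality (Σ[ p ∈ Partition n ] (#evenParts p ≡ a × #oddParts p ≡ b)) k)
theorem2p3 n a b with refined-finite n a b
... | k , finite = k , ↔-trans (pairing↔parity n a b) finite , finite
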